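{- Let $\mathbb{F}$ be a field of characteristic $0$. If $\mathrm{sdet}_{2n}(X)$, with $X=\{x_{ij}:1\le i,j\le 2n\}$, can be computed by polynomial-size (in $n$) noncommutative arithmetic circuits over $\mathbb{F}$, then $\mathrm{Cperm}_n(Y)$, with $Y=\{y_{ij}:1\le i,j\le n\}$, can also be computed by polynomial-size noncommutative arithmetic circuits over $\mathbb{F}$.
   Context: All variables are noncommuting. The symmetrized determinant is $\mathrm{sdet}_N(X)=\frac{1}{N!}\sum_{\sigma,\tau\in S_N}\mathrm{sgn}(\sigma)\mathrm{sgn}(\tau)\,x_{\tau(1),\sigma(1)}x_{\tau(2),\sigma(2)}\cdots x_{\tau(N),\sigma(N)}$ and the Cayley permanent is $\mathrm{Cperm}_n(Y)=\sum_{\sigma\in S_n}y_{1,\sigma(1)}\cdots y_{n,\sigma(n)}$ (products in written order). A noncommutative arithmetic circuit over $\mathbb{F}$ is a directed acyclic graph with leaves labelled by variables or field elements and internal fan-in-two addition and multiplication gates, each multiplication gate having ordered (left, right) children; it computes a polynomial in the free noncommutative polynomial ring at a designated output gate; its size is the number of nodes. -}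

module Defs where

open import Level using (Level; _⊔_) renaming (suc to lsuc)
open import Algebra.Bundles using (CommutativeRing)
open import Relation.Nullary using (¬_; yes; no)
open import Relation.Binary.Definitions using (DecidableEquality)
open import Relation.Binary.PropositionalEquality using (_≡_)
open import Data.Nat as ℕ using (ℕ; zero; suc; _≤_; _^_; _!)
open import Data.Bool using (Bool; true; false; _∧_; if_then_else_)
open import Data.Fin as Fin using (Fin; zero; suc)
open import Data.Fin.Properties using () renaming (_≟_ to _≟F_)
open import Data.Product using (Σ; ∃; ∃-syntax; _×_; _,_; proj₁; proj₂)
open import Data.Product.Properties using () renaming (≡-dec to ×-dec)
open import Data.List as List using (List; []; _∷_; _++_; map; concatMap; filter; allFin; foldr; length)
open import Data.List.Properties using () renaming (≡-dec to list-dec)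
open import Data.Vec as Vec using (Vec; lookup)
open import Relation.Nullary.Decidable using (⌊_⌋)
open import Data.Nat.Properties using (1≤n!)

record Field (c ℓ : Level) : Set (lsuc (c ⊔ ℓ)) where
  field
    commutativeRing : CommutativeRing c ℓ
  open CommutativeRing commutativeRing public
  field
    0≉1      : ¬ (0# ≈ 1#)
    inv      : (x : Carrier) → ¬ (x ≈ 0#) → Carrier
    inverseʳ : (x : Carrier) (p : ¬ (x ≈ 0#)) → x * inv x p ≈ 1#

module FieldOps {c ℓ} (F : Field c ℓ) where
  open Field F using (Carrier; _≈_; _+_; 0#; 1#)

  natF : ℕ → Carrier
  natF zero    = 0#
  natF (suc n) = 1# + natF n

  CharZero : Set ℓ
  CharZero = (n : ℕ) → ¬ (natF (suc n) ≈ 0#)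

allVecs : (N m : ℕ) → List (Vec (Fin N) m)
allVecs N zero    = Vec.[] ∷ []
allVecs N (suc m) = concatMap (λ i → map (i Vec.∷_) (allVecs N m)) (allFin N)

ordPairs : (N : ℕ) → List (Fin N × Fin N)
ordPairs N = concatMap (λ i → map (i ,_) (filter (λ j → i Fin.<? j) (allFin N))) (allFin N)

isPerm : {N : ℕ} → Vec (Fin N) N → Bool
isPerm {N} v = foldr (λ p b → (if ⌊ lookup v (proj₁ p) ≟F lookup v (proj₂ p) ⌋ then false else true) ∧ b)
                     true (ordPairs N)

perms : (N : ℕ) → List (Vec (Fin N) N)
perms N = filter (λ v → Data.Bool._≟_ (isPerm v) true) (allVecs N N)
  where import Data.Bool

inversions : {N : ℕ} → Vec (Fin N) N → ℕ
inversions {N} σ = length (filter (λ p → lookup σ (proj₂ p) Fin.<? lookup σ (proj₁ p)) (ordPairs N))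

-- Noncommutative polynomials over F in variables V, represented by their
-- coefficient function on words (monomials) over V.  Equality of
-- polynomials is coefficientwise equality in F.

module NCPoly {c ℓ} (F : Field c ℓ) where
  open Field F using (Carrier; _≈_; _+_; _*_; -_; 0#; 1#; inv)
  open FieldOps F public

  Poly : Set → Set c
  Poly V = List V → Carrier

  _≐_ : {V : Set} → Poly V → Poly V → Set ℓ
  p ≐ q = ∀ w → p w ≈ q w

  sumF : List Carrier → Carrier
  sumF = foldr _+_ 0#

  splits : {V : Set} → List V → List (List V × List V)
  splits []       = ([] , []) ∷ []
  splits (x ∷ xs) = ([] , x ∷ xs) ∷ map (λ p → (x ∷ proj₁ p , proj₂ p)) (splits xs)

  zeroP : {V : Set} → Poly V
  zeroP _ = 0#

  constP : {V : Set} → Carrier → Poly V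
  constP a []      = a
  constP a (_ ∷ _) = 0#

  _⊕_ : {V : Set} → Poly V → Poly V → Poly V
  (p ⊕ q) w = p w + q w

  _⊗_ : {V : Set} → Poly V → Poly V → Poly V
  (p ⊗ q) w = sumF (map (λ s → p (proj₁ s) * q (proj₂ s)) (splits w))

  scale : {V : Set} → Carrier → Poly V → Poly V
  scale a p w = a * p w

  sumP : {V A : Set} → List A → (A → Poly V) → Poly V
  sumP xs f = foldr (λ x acc → f x ⊕ acc) zeroP xs

  monomial : {V : Set} → DecidableEquality V → List V → Poly V
  monomial eq w u with list-dec eq u w
  ... | yes _ = 1#
  ... | no  _ = 0#

  varP : {V : Set} → DecidableEquality V → V → Poly V
  varP eq v = monomial eq (v ∷ [])

  signF : ℕ → Carrier
  signF zero    = 1#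
  signF (suc k) = - signF k

  sgn : {N : ℕ} → Vec (Fin N) N → Carrier
  sgn σ = signF (inversions σ)

  MatVar : ℕ → Set
  MatVar N = Fin N × Fin N

  matEq : {N : ℕ} → DecidableEquality (MatVar N)
  matEq = ×-dec _≟F_ _≟F_

  sdetWord : {N : ℕ} → Vec (Fin N) N → Vec (Fin N) N → List (MatVar N)
  sdetWord {N} τ σ = map (λ k → (lookup τ k , lookup σ k)) (allFin N)

  cpermWord : {n : ℕ} → Vec (Fin n) n → List (MatVar n)
  cpermWord {n} σ = map (λ k → (k , lookup σ k)) (allFin n)

  factNonzero : CharZero → (N : ℕ) → ¬ (natF (N !) ≈ 0#)
  factNonzero ch N with N ! | 1≤n! N
  ... | suc m | _  = ch m

  sdet : CharZero → (N : ℕ) → Poly (MatVar N)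
  sdet ch N = scale (inv (natF (N !)) (factNonzero ch N))
                (sumP (perms N) λ σ → sumP (perms N) λ τ →
                   scale (sgn σ * sgn τ) (monomial matEq (sdetWord τ σ)))

  Cperm : (n : ℕ) → Poly (MatVar n)
  Cperm n = sumP (perms n) λ σ → monomial matEq (cpermWord σ)

  -- Noncommutative arithmetic circuits as straight-line programs
  -- (a topologically ordered DAG).  A circuit with k nodes is a list of
  -- k gates; a gate may refer only to earlier nodes, index zero being the
  -- most recently added node.  Size = number of nodes.

  data Gate (V : Set) (k : ℕ) : Set c where
    var   : V → Gate V k
    const : Carrier → Gate V k
    add   : Fin k → Fin k → Gate V k
    mul   : Fin k → Fin k → Gate V k

  data Circuit (V : Set) : ℕ → Set c where
    []  : Circuit V zero
    _▷_ : {k : ℕ} → Circuit V k → Gate V k → Circuit V (suc k)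

  module _ {V : Set} (eq : DecidableEquality V) where
    evalGate : {k : ℕ} → (Fin k → Poly V) → Gate V k → Poly V
    evalGate vals (var v)   = varP eq v
    evalGate vals (const a) = constP a
    evalGate vals (add i j) = vals i ⊕ vals j
    evalGate vals (mul i j) = vals i ⊗ vals j

    evalNodes : {k : ℕ} → Circuit V k → Fin k → Poly V
    evalNodes (C ▷ g) zero    = evalGate (evalNodes C) g
    evalNodes (C ▷ g) (suc i) = evalNodes C i

    ComputedInSize : Poly V → ℕ → Set (c ⊔ ℓ)
    ComputedInSize p s = Σ (Circuit V s) λ C → Σ (Fin s) λ out → evalNodes C out ≐ p

  PolySizeFamily : (V : ℕ → Set) → ((n : ℕ) → DecidableEquality (V n)) →
                   ((n : ℕ) → Poly (V n)) → Set (c ⊔ ℓ)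
  PolySizeFamily V eqs p =
    ∃[ a ] ∃[ b ] ((n : ℕ) → ∃[ s ] (s ≤ a ℕ.* n ^ b ℕ.+ a × ComputedInSize (eqs n) (p n) s))

{-# OPTIONS --safe #-}
-- On the words x_{v₀v₀} x_{v₁v₁} ⋯ only the summands σ = τ = v of sdet survive, and there both
-- signs cancel; so N! · sdet_N has coefficient 1 at such a word if v is a permutation and 0 otherwise.
-- For N = n + m, fixing the last m diagonal entries makes v range over S_n, and reading the k-th of
-- the first n letters x_{jj} as y_{kj} turns the restricted polynomial into Cperm_n.
-- Both operations, reading a letter in a prescribed position and stripping a prescribed letter, are
-- the steps of a list S; the polynomial pulled back along S satisfies
--   pull S (p ⊗ q) = Σ_{S = S₁ S₂} pull S₁ p ⊗ pull S₂ q,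
-- so a circuit for p yields one for pull S p that computes, for each old node, its pullbacks along
-- all contiguous factors of S.
module Submission where

open import Defs
open import Level using (Level)
open import Data.Nat using (ℕ; _*_)

open import Level using (_⊔_)
open import Data.Nat as ℕ using (zero; suc; _+_; _^_; _≤_; _!; z≤n; s≤s)
import Data.Nat.Properties as ℕₚ
open import Data.Nat.Solver using (module +-*-Solver)
open import Data.Bool as Bool using (Bool; true; false; _∧_; if_then_else_)
open import Data.Fin as Fin using (Fin; zero; suc; _↑ˡ_; _↑ʳ_; splitAt)
import Data.Fin.Properties as Finₚ
open import Data.Product using (Σ-syntax; ∃-syntax; _×_; _,_; proj₁; proj₂)
open import Data.Sum using (_⊎_; inj₁; inj₂)
open import Data.List using (List; []; _∷_; _++_; map; concatMap; filter; allFin; foldr; length;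
  cartesianProductWith; tabulate)
import Data.List.Properties as Listₚ
open import Data.List.Relation.Unary.All as All using (All; []; _∷_)
import Data.List.Relation.Unary.All.Properties as Allₚ
open import Data.List.Relation.Unary.Any as Any using (here; there)
open import Data.List.Relation.Unary.AllPairs using ([]; _∷_)
open import Data.List.Relation.Unary.Unique.Propositional using (Unique)
import Data.List.Relation.Unary.Unique.Propositional.Properties as Uniqueₚ
open import Data.List.Membership.Propositional using (_∈_; find; lose)
open import Data.List.Membership.Propositional.Properties
open import Data.Vec as Vec using (Vec; lookup)
import Data.Vec.Properties as Vecₚ
open import Function using (_∘_; id; Injective)
open import Relation.Binary.Definitions using (DecidableEquality; tri<; tri≈; tri>)
open import Relation.Binary.PropositionalEquality as ≡
  using (_≡_; _≢_; refl; cong; cong₂; subst; module ≡-Reasoning)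
open import Relation.Nullary using (¬_; Dec; yes; no; contradiction)
open import Relation.Nullary.Decidable using (⌊_⌋)

-- Closure of polynomial growth under sums and products.

-- The bound has the shape demanded by `PolySizeFamily`, so its two witnesses can be handed over
-- directly.
PolyBounded : (ℕ → ℕ) → Set
PolyBounded f = ∃[ a ] ∃[ b ] (∀ n → f n ≤ a * n ^ b + a)

const-polyBounded : ∀ k → PolyBounded (λ _ → k)
const-polyBounded k = k , 0 , λ n → ℕₚ.m≤n+m k (k * n ^ 0)

id-polyBounded : PolyBounded id
id-polyBounded = 1 , 1 , λ n → ℕₚ.≤-trans (ℕₚ.≤-reflexive (lemma n)) (ℕₚ.m≤m+n _ 1)
  where
  open +-*-Solver
  lemma : ∀ n → n ≡ 1 * n ^ 1
  lemma = solve 1 (λ n → n := con 1 :* n :^ 1) refl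

-- The summand 1 is needed for n = 0, where 0 ^ 0 = 1.
^-monoʳ : ∀ n b d → n ^ b ≤ n ^ (b + d) + 1
^-monoʳ zero    zero    d = ℕₚ.m≤n+m 1 (0 ^ d)
^-monoʳ zero    (suc b) d = z≤n
^-monoʳ (suc n) b       d =
  ℕₚ.≤-trans (ℕₚ.^-monoʳ-≤ (suc n) (ℕₚ.m≤m+n b d)) (ℕₚ.m≤m+n _ 1)

^-monoʳ′ : ∀ n b d → n ^ d ≤ n ^ (b + d) + 1
^-monoʳ′ n b d = subst (λ e → n ^ d ≤ n ^ e + 1) (ℕₚ.+-comm d b) (^-monoʳ n d b)

+-polyBounded : ∀ {f g} → PolyBounded f → PolyBounded g → PolyBounded (λ n → f n + g n)
+-polyBounded {f} {g} (a , b , f≤) (c , d , g≤) = 2 * (a + c) , b + d , λ n →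
  let x = n ^ (b + d) in begin
  f n + g n                                   ≤⟨ ℕₚ.+-mono-≤ (f≤ n) (g≤ n) ⟩
  (a * n ^ b + a) + (c * n ^ d + c)           ≤⟨ ℕₚ.+-mono-≤
                                                  (ℕₚ.+-monoˡ-≤ a (ℕₚ.*-monoʳ-≤ a (^-monoʳ n b d)))
                                                  (ℕₚ.+-monoˡ-≤ c (ℕₚ.*-monoʳ-≤ c (^-monoʳ′ n b d))) ⟩
  -- The left side is (a + c) x + 2 (a + c). Adding (a + c) x as slack makes both coefficients
  -- equal.
  (a * (x + 1) + a) + (c * (x + 1) + c)       ≤⟨ ℕₚ.m≤m+n _ ((a + c) * x) ⟩
  (a * (x + 1) + a) + (c * (x + 1) + c) + (a + c) * x
                                              ≡⟨ lemma a c x ⟩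
  2 * (a + c) * x + 2 * (a + c)               ∎
  where
  open ℕₚ.≤-Reasoning
  open +-*-Solver
  lemma : ∀ a c x → (a * (x + 1) + a) + (c * (x + 1) + c) + (a + c) * x
                  ≡ 2 * (a + c) * x + 2 * (a + c)
  lemma = solve 3 (λ a c x →
    (a :* (x :+ con 1) :+ a) :+ (c :* (x :+ con 1) :+ c) :+ (a :+ c) :* x
      := con 2 :* (a :+ c) :* x :+ con 2 :* (a :+ c)) refl

*-polyBounded : ∀ {f g} → PolyBounded f → PolyBounded g → PolyBounded (λ n → f n * g n)
*-polyBounded {f} {g} (a , b , f≤) (c , d , g≤) = 3 * (a * c) , b + d , λ n →
  let x = n ^ (b + d) in begin
  f n * g n                                   ≤⟨ ℕₚ.*-mono-≤ (f≤ n) (g≤ n) ⟩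
  (a * n ^ b + a) * (c * n ^ d + c)           ≡⟨ expand a c (n ^ b) (n ^ d) ⟩
  a * c * (n ^ b * n ^ d + n ^ b + n ^ d + 1) ≡⟨ cong (λ y → a * c * (y + n ^ b + n ^ d + 1))
                                                      (ℕₚ.^-distribˡ-+-* n b d) ⟨
  a * c * (x + n ^ b + n ^ d + 1)             ≤⟨ ℕₚ.*-monoʳ-≤ (a * c) (ℕₚ.+-monoˡ-≤ 1
                                                  (ℕₚ.+-mono-≤ (ℕₚ.+-monoʳ-≤ x (^-monoʳ n b d))
                                                               (^-monoʳ′ n b d))) ⟩
  -- Each of the cross terms `n ^ b` and `n ^ d` is at most x + 1, which leaves 3 x + 3 and explains
  -- the factor 3.
  a * c * (x + (x + 1) + (x + 1) + 1)         ≡⟨ collect (a * c) x ⟩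
  3 * (a * c) * x + 3 * (a * c)               ∎
  where
  open ℕₚ.≤-Reasoning
  open +-*-Solver
  expand : ∀ a c u v → (a * u + a) * (c * v + c) ≡ a * c * (u * v + u + v + 1)
  expand = solve 4 (λ a c u v →
    (a :* u :+ a) :* (c :* v :+ c) := a :* c :* (u :* v :+ u :+ v :+ con 1)) refl
  collect : ∀ e x → e * (x + (x + 1) + (x + 1) + 1) ≡ 3 * e * x + 3 * e
  collect = solve 2 (λ e x →
    e :* (x :+ (x :+ con 1) :+ (x :+ con 1) :+ con 1) := con 3 :* e :* x :+ con 3 :* e) refl

-- Lists, vectors and tabulation.

-- Recasts the recursion of `allVecs` as a product of lists, so that membership and uniqueness
-- follow factor by factor.
concatMap-map≡cartesianProductWith : ∀ {A B C : Set} (f : A → B → C) xs ys →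
  concatMap (λ x → map (f x) ys) xs ≡ cartesianProductWith f xs ys
concatMap-map≡cartesianProductWith f []       ys = refl
concatMap-map≡cartesianProductWith f (x ∷ xs) ys =
  cong (map (f x) ys ++_) (concatMap-map≡cartesianProductWith f xs ys)

length-concatMap : ∀ {A B : Set} {f : A → List B} {b} xs → (∀ {x} → x ∈ xs → length (f x) ≤ b) →
  length (concatMap f xs) ≤ length xs * b
length-concatMap []       len = z≤n
length-concatMap {f = f} (x ∷ xs) len =
  ℕₚ.≤-trans (ℕₚ.≤-reflexive (Listₚ.length-++ (f x)))
    (ℕₚ.+-mono-≤ (len (here refl)) (length-concatMap xs (len ∘ there)))

length-infix : ∀ {A : Set} (u v w : List A) → length v ≤ length (u ++ v ++ w)
length-infix u v w = begin
  length v                           ≤⟨ ℕₚ.m≤m+n (length v) (length w) ⟩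
  length v + length w                ≤⟨ ℕₚ.m≤n+m _ (length u) ⟩
  length u + (length v + length w)   ≡⟨ cong (length u +_) (Listₚ.length-++ v) ⟨
  length u + length (v ++ w)         ≡⟨ Listₚ.length-++ u ⟨
  length (u ++ v ++ w)               ∎
  where open ℕₚ.≤-Reasoning

-- Serves to cut the diagonal word of length n + m into its n free and its m fixed letters.
tabulate-+ : ∀ {A : Set} n {m} (f : Fin (n + m) → A) →
  tabulate f ≡ tabulate (λ i → f (i ↑ˡ m)) ++ tabulate (λ i → f (n ↑ʳ i))
tabulate-+ zero    f = refl
tabulate-+ (suc n) f = cong (f zero ∷_) (tabulate-+ n (f ∘ suc))

tabulate-injective : ∀ {A : Set} {n} {f g : Fin n → A} → tabulate f ≡ tabulate g → ∀ i → f i ≡ g i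
tabulate-injective eq zero    = Listₚ.∷-injectiveˡ eq
tabulate-injective eq (suc i) = tabulate-injective (Listₚ.∷-injectiveʳ eq) i

lookup-injective : ∀ {A : Set} {n} {v w : Vec A n} → (∀ i → lookup v i ≡ lookup w i) → v ≡ w
lookup-injective {v = v} {w} eq = begin
  v                       ≡⟨ Vecₚ.tabulate∘lookup v ⟨
  Vec.tabulate (lookup v) ≡⟨ Vecₚ.tabulate-cong eq ⟩
  Vec.tabulate (lookup w) ≡⟨ Vecₚ.tabulate∘lookup w ⟩
  w                       ∎
  where open ≡-Reasoning

foldr-∧⁻ : ∀ {A : Set} (t : A → Bool) {xs} → foldr (λ x b → t x ∧ b) true xs ≡ true →
  ∀ {x} → x ∈ xs → t x ≡ true
foldr-∧⁻ t {y ∷ xs} eq x∈ with t y in ty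
foldr-∧⁻ t {y ∷ xs} eq (here refl) | true = ty
foldr-∧⁻ t {y ∷ xs} eq (there x∈)  | true = foldr-∧⁻ t eq x∈

foldr-∧⁺ : ∀ {A : Set} (t : A → Bool) {xs} → (∀ {x} → x ∈ xs → t x ≡ true) →
  foldr (λ x b → t x ∧ b) true xs ≡ true
foldr-∧⁺ t {[]}     eq = refl
foldr-∧⁺ t {x ∷ xs} eq rewrite eq (here refl) = foldr-∧⁺ t (eq ∘ there)

-- Permutations as injective vectors, each listed once.

∈-ordPairs⁺ : ∀ {N} {i j : Fin N} → i Fin.< j → (i , j) ∈ ordPairs N
∈-ordPairs⁺ {N} {i} {j} i<j =
  ∈-concatMap⁺ (λ i → map (i ,_) (filter (i Fin.<?_) (allFin N)))
    (lose (∈-allFin i) (∈-map⁺ (i ,_) (∈-filter⁺ (i Fin.<?_) (∈-allFin j) i<j)))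

∈-ordPairs⁻ : ∀ {N} {i j : Fin N} → (i , j) ∈ ordPairs N → i Fin.< j
∈-ordPairs⁻ {N} {i} {j} p
  with Any.satisfied
         (∈-concatMap⁻ (λ i → map (i ,_) (filter (i Fin.<?_) (allFin N))) {xs = allFin N} p)
... | k , q with ∈-map⁻ (k ,_) q
... | l , l∈ , refl = proj₂ (∈-filter⁻ (k Fin.<?_) {xs = allFin N} l∈)

module _ {N : ℕ} (v : Vec (Fin N) N) where

  -- The test that `isPerm` folds over `ordPairs`, spelled identically so that `foldr-∧⁻` and
  -- `foldr-∧⁺` apply to `isPerm` itself.
  distinct : Fin N × Fin N → Bool
  distinct p = if ⌊ lookup v (proj₁ p) Finₚ.≟ lookup v (proj₂ p) ⌋ then false else true

  distinct⁻ : ∀ p → distinct p ≡ true → lookup v (proj₁ p) ≢ lookup v (proj₂ p)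
  distinct⁻ p eq with lookup v (proj₁ p) Finₚ.≟ lookup v (proj₂ p)
  ... | no ≢ = ≢

  distinct⁺ : ∀ p → lookup v (proj₁ p) ≢ lookup v (proj₂ p) → distinct p ≡ true
  distinct⁺ p ≢ with lookup v (proj₁ p) Finₚ.≟ lookup v (proj₂ p)
  ... | yes eq = contradiction eq ≢
  ... | no _   = refl

  isPerm⇒injective : isPerm v ≡ true → Injective _≡_ _≡_ (lookup v)
  isPerm⇒injective perm {i} {j} eq with Finₚ.<-cmp i j
  ... | tri< i<j _ _ =
    contradiction eq (distinct⁻ (i , j) (foldr-∧⁻ distinct perm (∈-ordPairs⁺ i<j)))
  ... | tri≈ _ i≡j _ = i≡j
  ... | tri> _ _ j<i =
    contradiction (≡.sym eq) (distinct⁻ (j , i) (foldr-∧⁻ distinct perm (∈-ordPairs⁺ j<i)))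

  injective⇒isPerm : Injective _≡_ _≡_ (lookup v) → isPerm v ≡ true
  injective⇒isPerm inj = foldr-∧⁺ distinct λ {(i , j)} p →
    distinct⁺ (i , j) (Finₚ.<⇒≢ (∈-ordPairs⁻ p) ∘ inj)

allVecs-complete : ∀ {N m} (v : Vec (Fin N) m) → v ∈ allVecs N m
allVecs-complete Vec.[]      = here refl
allVecs-complete {N} {suc m} (i Vec.∷ v) =
  subst (_ ∈_) (≡.sym (concatMap-map≡cartesianProductWith Vec._∷_ (allFin N) (allVecs N m)))
    (∈-cartesianProductWith⁺ Vec._∷_ (∈-allFin i) (allVecs-complete v))

allVecs-unique : ∀ N m → Unique (allVecs N m)
allVecs-unique N zero    = [] ∷ []
allVecs-unique N (suc m) =
  subst Unique (≡.sym (concatMap-map≡cartesianProductWith Vec._∷_ (allFin N) (allVecs N m)))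
    (Uniqueₚ.cartesianProductWith⁺ Vec._∷_ (λ eq → Vecₚ.∷-injective eq)
      (Uniqueₚ.allFin⁺ N) (allVecs-unique N m))

-- A repetition in `perms` would multiply coefficients; uniqueness makes the surviving summand count
-- exactly once.
perms-unique : ∀ N → Unique (perms N)
perms-unique N = Uniqueₚ.filter⁺ _ (allVecs-unique N N)

∈-perms⁺ : ∀ {N} (v : Vec (Fin N) N) → Injective _≡_ _≡_ (lookup v) → v ∈ perms N
∈-perms⁺ v inj = ∈-filter⁺ _ (allVecs-complete v) (injective⇒isPerm v inj)

∈-perms⁻ : ∀ {N} (v : Vec (Fin N) N) → v ∈ perms N → Injective _≡_ _≡_ (lookup v)
∈-perms⁻ {N} v p = isPerm⇒injective v (proj₂ (∈-filter⁻ _ {xs = allVecs N N} p))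

-- Extending a vector by m fixed points.

module _ {n : ℕ} (m : ℕ) (v : Vec (Fin n) n) where

  pad : Vec (Fin (n + m)) (n + m)
  pad = Vec.map (_↑ˡ m) v Vec.++ Vec.tabulate (n ↑ʳ_)

  lookup-pad-↑ˡ : ∀ i → lookup pad (i ↑ˡ m) ≡ lookup v i ↑ˡ m
  lookup-pad-↑ˡ i = ≡.trans (Vecₚ.lookup-++ˡ (Vec.map (_↑ˡ m) v) _ i) (Vecₚ.lookup-map i _ v)

  lookup-pad-↑ʳ : ∀ i → lookup pad (n ↑ʳ i) ≡ n ↑ʳ i
  lookup-pad-↑ʳ i = ≡.trans (Vecₚ.lookup-++ʳ (Vec.map (_↑ˡ m) v) _ i) (Vecₚ.lookup∘tabulate _ i)

  ↑ˡ≢↑ʳ : ∀ {i : Fin n} {j : Fin m} → i ↑ˡ m ≢ n ↑ʳ j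
  ↑ˡ≢↑ʳ {i} {j} eq
    with () ← ≡.trans (≡.sym (Finₚ.splitAt-↑ˡ n i m))
                      (≡.trans (cong (splitAt n) eq) (Finₚ.splitAt-↑ʳ n m j))

  -- The two blocks of `pad` take values in the disjoint ranges of `_↑ˡ m` and `n ↑ʳ_`, so a
  -- collision can only occur inside one block.
  pad-injective⁺ : Injective _≡_ _≡_ (lookup v) → Injective _≡_ _≡_ (lookup pad)
  pad-injective⁺ inj {i} {j} eq
    with splitAt n i | Finₚ.join-splitAt n m i | splitAt n j | Finₚ.join-splitAt n m j
  ... | inj₁ a | refl | inj₁ b | refl = cong (_↑ˡ m) (inj (Finₚ.↑ˡ-injective m _ _
        (≡.trans (≡.sym (lookup-pad-↑ˡ a)) (≡.trans eq (lookup-pad-↑ˡ b)))))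
  ... | inj₁ a | refl | inj₂ b | refl = contradiction
        (≡.trans (≡.sym (lookup-pad-↑ˡ a)) (≡.trans eq (lookup-pad-↑ʳ b))) ↑ˡ≢↑ʳ
  ... | inj₂ a | refl | inj₁ b | refl = contradiction
        (≡.trans (≡.sym (lookup-pad-↑ˡ b)) (≡.trans (≡.sym eq) (lookup-pad-↑ʳ a))) ↑ˡ≢↑ʳ
  ... | inj₂ a | refl | inj₂ b | refl =
        ≡.trans (≡.sym (lookup-pad-↑ʳ a)) (≡.trans eq (lookup-pad-↑ʳ b))

  pad-injective⁻ : Injective _≡_ _≡_ (lookup pad) → Injective _≡_ _≡_ (lookup v)
  pad-injective⁻ inj {i} {j} eq = Finₚ.↑ˡ-injective m i j (inj
    (≡.trans (lookup-pad-↑ˡ i) (≡.trans (cong (_↑ˡ m) eq) (≡.sym (lookup-pad-↑ˡ j)))))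

-- Steps, and coefficient arithmetic of noncommutative polynomials.

-- A list of steps is a partial translation of words over `MatVar n` into words over X: `read k`
-- consumes a letter of row k and translates it according to its column, while `emit x` writes x and
-- consumes nothing.
data Step (X : Set) (n : ℕ) : Set where
  read : Fin n → Step X n
  emit : X → Step X n

module Polynomials {c ℓ} (F : Field c ℓ) where
  open Field F hiding (_+_; zero)
    renaming (_*_ to _·_; refl to ≈-refl; sym to ≈-sym; trans to ≈-trans)
  open Field F using () renaming (_+_ to _∔_)
  open NCPoly F
  open import Algebra.Properties.Ring ring using (-‿distribˡ-*; -‿distribʳ-*; -‿involutive)
  open import Relation.Binary.Reasoning.Setoid setoid

  sumF-cong : ∀ {A : Set} {f g : A → Carrier} → (∀ x → f x ≈ g x) → ∀ xs →
    sumF (map f xs) ≈ sumF (map g xs)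
  sumF-cong eq []       = ≈-refl
  sumF-cong eq (x ∷ xs) = +-cong (eq x) (sumF-cong eq xs)

  sumF-zero : ∀ {A : Set} {f : A → Carrier} → (∀ x → f x ≈ 0#) → ∀ xs → sumF (map f xs) ≈ 0#
  sumF-zero eq []       = ≈-refl
  sumF-zero eq (x ∷ xs) = ≈-trans (+-cong (eq x) (sumF-zero eq xs)) (+-identityˡ 0#)

  module _ {V : Set} where

    ≐-sym : {p q : Poly V} → p ≐ q → q ≐ p
    ≐-sym eq w = ≈-sym (eq w)

    ≐-trans : {p q r : Poly V} → p ≐ q → q ≐ r → p ≐ r
    ≐-trans eq eq′ w = ≈-trans (eq w) (eq′ w)

    -- The left quotient of a formal series by the letter x.
    ∂ : V → Poly V → Poly V
    ∂ x p w = p (x ∷ w)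

    ⊕-cong : {p p′ q q′ : Poly V} → p ≐ p′ → q ≐ q′ → (p ⊕ q) ≐ (p′ ⊕ q′)
    ⊕-cong eq eq′ w = +-cong (eq w) (eq′ w)

    ⊗-cong : {p p′ q q′ : Poly V} → p ≐ p′ → q ≐ q′ → (p ⊗ q) ≐ (p′ ⊗ q′)
    ⊗-cong eq eq′ w = sumF-cong (λ s → *-cong (eq (proj₁ s)) (eq′ (proj₂ s))) (splits w)

    ⊗-[] : (p q : Poly V) → (p ⊗ q) [] ≈ p [] · q []
    ⊗-[] p q = +-identityʳ _

    -- A splitting of x w either leaves the whole word to q or puts x at the head of the part
    -- belonging to p.
    ⊗-∷ : (p q : Poly V) → ∀ x w → (p ⊗ q) (x ∷ w) ≈ p [] · q (x ∷ w) ∔ (∂ x p ⊗ q) w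
    ⊗-∷ p q x w = +-congˡ (reflexive (cong sumF (≡.sym (Listₚ.map-∘ (splits w)))))

    zeroP-⊗ : (q : Poly V) → ∀ w → (zeroP ⊗ q) w ≈ 0#
    zeroP-⊗ q w = sumF-zero (λ s → zeroˡ (q (proj₂ s))) (splits w)

    constP-⊗ : ∀ a (q : Poly V) → (constP a ⊗ q) ≐ scale a q
    constP-⊗ a q []      = ⊗-[] (constP a) q
    constP-⊗ a q (x ∷ w) = begin
      (constP a ⊗ q) (x ∷ w)           ≈⟨ ⊗-∷ (constP a) q x w ⟩
      a · q (x ∷ w) ∔ (zeroP ⊗ q) w    ≈⟨ +-congˡ (zeroP-⊗ q w) ⟩
      a · q (x ∷ w) ∔ 0#               ≈⟨ +-identityʳ _ ⟩
      a · q (x ∷ w)                    ∎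

    constP-0 : constP {V} 0# ≐ zeroP
    constP-0 []      = ≈-refl
    constP-0 (_ ∷ _) = ≈-refl

    sumP-zero : ∀ {A : Set} {f : A → Poly V} {w} xs → (∀ {x} → x ∈ xs → f x w ≈ 0#) →
      sumP xs f w ≈ 0#
    sumP-zero []       eq = ≈-refl
    sumP-zero (x ∷ xs) eq =
      ≈-trans (+-cong (eq (here refl)) (sumP-zero xs (eq ∘ there))) (+-identityˡ 0#)

    -- Two words are allowed because `pull-⊗` compares a sum at u with a sum at a word one letter
    -- longer.
    sumP-cong : ∀ {A : Set} {f g : A → Poly V} {w w′} xs → (∀ x → f x w ≈ g x w′) →
      sumP xs f w ≈ sumP xs g w′
    sumP-cong []       eq = ≈-refl
    sumP-cong (x ∷ xs) eq = +-cong (eq x) (sumP-cong xs eq)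

    sumP-single : ∀ {A : Set} {f : A → Poly V} {w x xs} → Unique xs → x ∈ xs →
      (∀ {y} → y ≢ x → f y w ≈ 0#) → sumP xs f w ≈ f x w
    sumP-single {xs = x ∷ xs} (x∉ ∷ _) (here refl) eq =
      ≈-trans (+-congˡ (sumP-zero xs λ y∈ → eq (All.lookup x∉ y∈ ∘ ≡.sym))) (+-identityʳ _)
    sumP-single {xs = y ∷ xs} (y∉ ∷ u) (there x∈) eq =
      ≈-trans (+-cong (eq (All.lookup y∉ x∈)) (sumP-single u x∈ eq)) (+-identityˡ _)

    sumP-map : ∀ {A B : Set} (h : A → B) {f : B → Poly V} {g : A → Poly V} →
      ∀ {w} → (∀ x → f (h x) w ≈ g x w) → ∀ xs → sumP (map h xs) f w ≈ sumP xs g w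
    sumP-map h eq []       = ≈-refl
    sumP-map h eq (x ∷ xs) = +-cong (eq x) (sumP-map h eq xs)

    module _ (_≟_ : DecidableEquality V) where

      monomial-≡ : ∀ w → monomial _≟_ w w ≡ 1#
      monomial-≡ w with Listₚ.≡-dec _≟_ w w
      ... | yes _ = refl
      ... | no  ≢ = contradiction refl ≢

      monomial-≢ : ∀ w u → u ≢ w → monomial _≟_ w u ≡ 0#
      monomial-≢ w u ≢ with Listₚ.≡-dec _≟_ u w
      ... | yes eq = contradiction eq ≢
      ... | no  _  = refl

    -- Contiguous factors of a word.

    ∈-splits⁻ : ∀ (w : List V) {s} → s ∈ splits w → proj₁ s ++ proj₂ s ≡ w
    ∈-splits⁻ []      (here refl) = refl
    ∈-splits⁻ (x ∷ w) (here refl) = refl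
    ∈-splits⁻ (x ∷ w) (there p) with ∈-map⁻ _ p
    ... | s , s∈ , refl = cong (x ∷_) (∈-splits⁻ w s∈)

    ∈-splits⁺ : ∀ (u v : List V) → (u , v) ∈ splits (u ++ v)
    ∈-splits⁺ []      []      = here refl
    ∈-splits⁺ []      (_ ∷ _) = here refl
    ∈-splits⁺ (x ∷ u) v       = there (∈-map⁺ _ (∈-splits⁺ u v))

    length-splits : ∀ (w : List V) → length (splits w) ≡ suc (length w)
    length-splits []      = refl
    length-splits (x ∷ w) = cong suc (≡.trans (Listₚ.length-map _ (splits w)) (length-splits w))

    -- Contiguous factors as prefixes of suffixes. Repetitions are harmless, since only membership
    -- and the quadratic length bound are needed.
    factors : List V → List (List V)
    factors w = concatMap (λ s → map proj₁ (splits (proj₂ s))) (splits w)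

    ∈-factors⁺ : ∀ u v w → v ∈ factors (u ++ v ++ w)
    ∈-factors⁺ u v w = ∈-concatMap⁺ _ {xs = splits (u ++ v ++ w)}
      (lose (∈-splits⁺ u (v ++ w)) (∈-map⁺ proj₁ (∈-splits⁺ v w)))

    ∈-factors⁻ : ∀ {v} w → v ∈ factors w → ∃[ u ] ∃[ u′ ] w ≡ u ++ v ++ u′
    ∈-factors⁻ w v∈
      with find (∈-concatMap⁻ (λ s → map proj₁ (splits (proj₂ s))) {xs = splits w} v∈)
    ... | (u , r) , ur∈ , v∈′ with ∈-map⁻ proj₁ v∈′
    ... | (v , u′) , vu′∈ , refl = u , u′ ,
      ≡.trans (≡.sym (∈-splits⁻ w ur∈)) (cong (u ++_) (≡.sym (∈-splits⁻ r vu′∈)))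

    -- If w = u a b u′, then a and b are again flanked by words inside w. This closure keeps the
    -- product rule `pull-⊗` within pullbacks along factors of one fixed list.
    factors-splits : ∀ {v} w → v ∈ factors w → ∀ {s} → s ∈ splits v →
      proj₁ s ∈ factors w × proj₂ s ∈ factors w
    factors-splits {v} w v∈ {a , b} s∈ with ∈-factors⁻ w v∈
    ... | u , u′ , refl with ∈-splits⁻ v s∈
    ... | refl =
      subst (λ t → a ∈ factors (u ++ t)) (≡.sym (Listₚ.++-assoc a b u′))
        (∈-factors⁺ u a (b ++ u′)) ,
      subst (λ t → b ∈ factors t)
        (≡.trans (Listₚ.++-assoc u a (b ++ u′)) (cong (u ++_) (≡.sym (Listₚ.++-assoc a b u′))))
        (∈-factors⁺ (u ++ a) b u′)

    length-factor : ∀ {v} w → v ∈ factors w → length v ≤ length w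
    length-factor {v} w v∈ with ∈-factors⁻ w v∈
    ... | u , u′ , refl = length-infix u v u′

    -- There are |w| + 1 suffixes, each with at most |w| + 1 prefixes.
    length-factors : ∀ w → length (factors w) ≤ suc (length w) * suc (length w)
    length-factors w = subst (λ k → length (factors w) ≤ k * suc (length w)) (length-splits w)
      (length-concatMap (splits w) λ {s} s∈ →
        ℕₚ.≤-trans (ℕₚ.≤-reflexive (≡.trans (Listₚ.length-map proj₁ (splits (proj₂ s)))
                                            (length-splits (proj₂ s))))
          (s≤s (ℕₚ.≤-trans (ℕₚ.m≤n+m _ (length (proj₁ s)))
            (ℕₚ.≤-reflexive (≡.trans (≡.sym (Listₚ.length-++ (proj₁ s)))
                                     (cong length (∈-splits⁻ w s∈)))))))

  -- Pullback of polynomials along a list of steps.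

  module Pullback {X : Set} (_≟X_ : DecidableEquality X) {n : ℕ}
                  (e : Fin n → X) (e-injective : Injective _≡_ _≡_ e) where

    -- Set apart from `pull` so that `pull` recurses on the steps alone, for all words at once.
    readP : Fin n → (Fin n → Poly (MatVar n)) → Poly (MatVar n)
    readP k p []             = 0#
    readP k p ((i , j) ∷ u) with i Finₚ.≟ k
    ... | yes _ = p j u
    ... | no  _ = 0#

    -- The coefficient at u is that of p at the translation of u, and zero where no translation
    -- exists: a wrong row, or too many or too few letters.
    pull : List (Step X n) → Poly X → Poly (MatVar n)
    pull []           p = constP (p [])
    pull (read k ∷ T) p = readP k (λ j → pull T (∂ (e j) p))
    pull (emit x ∷ T) p = pull T (∂ x p)

    -- Every step contributes one letter to w, and w depends on T and u but not on p. This
    -- uniformity reduces congruence and linearity of `pull` to the same facts about single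
    -- coefficients.
    pull-eval : ∀ T u →
      (∃[ w ] length w ≡ length T × (∀ p → pull T p u ≡ p w)) ⊎ (∀ p → pull T p u ≡ 0#)
    pull-eval []           []      = inj₁ ([] , refl , λ p → refl)
    pull-eval []           (_ ∷ _) = inj₂ λ p → refl
    pull-eval (read k ∷ T) []      = inj₂ λ p → refl
    pull-eval (read k ∷ T) ((i , j) ∷ u) with i Finₚ.≟ k
    ... | no  _ = inj₂ λ p → refl
    ... | yes _ with pull-eval T u
    ...   | inj₁ (w , len , eq) = inj₁ (e j ∷ w , cong suc len , λ p → eq (∂ (e j) p))
    ...   | inj₂ eq             = inj₂ λ p → eq (∂ (e j) p)
    pull-eval (emit x ∷ T) u with pull-eval T u
    ... | inj₁ (w , len , eq) = inj₁ (x ∷ w , cong suc len , λ p → eq (∂ x p))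
    ... | inj₂ eq             = inj₂ λ p → eq (∂ x p)

    pull-cong : ∀ T {p q} → p ≐ q → pull T p ≐ pull T q
    pull-cong T {p} {q} p≐q u with pull-eval T u
    ... | inj₁ (w , _ , eq) rewrite eq p | eq q = p≐q w
    ... | inj₂ eq           rewrite eq p | eq q = ≈-refl

    pull-⊕ : ∀ T p q → pull T (p ⊕ q) ≐ (pull T p ⊕ pull T q)
    pull-⊕ T p q u with pull-eval T u
    ... | inj₁ (w , _ , eq) rewrite eq (p ⊕ q) | eq p | eq q = ≈-refl
    ... | inj₂ eq           rewrite eq (p ⊕ q) | eq p | eq q = ≈-sym (+-identityˡ 0#)

    pull-scale : ∀ T a p → pull T (scale a p) ≐ scale a (pull T p)
    pull-scale T a p u with pull-eval T u
    ... | inj₁ (w , _ , eq) rewrite eq (scale a p) | eq p = ≈-refl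
    ... | inj₂ eq           rewrite eq (scale a p) | eq p = ≈-sym (zeroʳ a)

    pull-read-≢ : ∀ {i k} → i ≢ k → ∀ T p j → ∂ (i , j) (pull (read k ∷ T) p) ≐ zeroP
    pull-read-≢ {i} {k} i≢k T p j u with i Finₚ.≟ k
    ... | yes i≡k = contradiction i≡k i≢k
    ... | no  _   = ≈-refl

    pull-read-≡ : ∀ k T p j → ∂ (k , j) (pull (read k ∷ T) p) ≐ pull T (∂ (e j) p)
    pull-read-≡ k T p j u with k Finₚ.≟ k
    ... | yes _   = ≈-refl
    ... | no  k≢k = contradiction refl k≢k

    -- By `pull-eval`, `pull T` sees only the homogeneous component of degree |T|.
    pull-vanishing : ∀ T p → (∀ w → length w ≡ length T → p w ≈ 0#) → pull T p ≐ constP 0#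
    pull-vanishing T p p≈0 u with pull-eval T u
    ... | inj₁ (w , len , eq) rewrite eq p = ≈-trans (p≈0 w len) (≈-sym (constP-0 u))
    ... | inj₂ eq             rewrite eq p = ≈-sym (constP-0 u)

    pull-∂-⊗ : ∀ T x p q →
      pull T (∂ x (p ⊗ q)) ≐ (scale (p []) (pull T (∂ x q)) ⊕ pull T (∂ x p ⊗ q))
    pull-∂-⊗ T x p q u with pull-eval T u
    ... | inj₁ (w , _ , eq)
      rewrite eq (∂ x (p ⊗ q)) | eq (∂ x q) | eq (∂ x p ⊗ q) = ⊗-∷ p q x w
    ... | inj₂ eq
      rewrite eq (∂ x (p ⊗ q)) | eq (∂ x q) | eq (∂ x p ⊗ q) =
      ≈-sym (≈-trans (+-identityʳ _) (zeroʳ (p [])))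

    -- Induction on T through `⊗-∷`: the splitting with empty left part gives the term with `p []`,
    -- and in all others the first step acts on p.
    pull-⊗ : ∀ T p q → pull T (p ⊗ q) ≐ sumP (splits T) (λ s → pull (proj₁ s) p ⊗ pull (proj₂ s) q)
    pull-⊗ [] p q u = begin
      constP ((p ⊗ q) []) u                        ≈⟨ lemma u ⟩
      scale (p []) (constP (q [])) u               ≈⟨ constP-⊗ (p []) (constP (q [])) u ⟨
      (constP (p []) ⊗ constP (q [])) u            ≈⟨ +-identityʳ _ ⟨
      (constP (p []) ⊗ constP (q [])) u ∔ 0#       ∎
      where
      lemma : constP ((p ⊗ q) []) ≐ scale (p []) (constP (q []))
      lemma []      = ⊗-[] p q
      lemma (_ ∷ _) = ≈-sym (zeroʳ (p []))
    pull-⊗ (emit x ∷ T) p q u = begin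
      pull T (∂ x (p ⊗ q)) u
        ≈⟨ pull-∂-⊗ T x p q u ⟩
      p [] · pull T (∂ x q) u ∔ pull T (∂ x p ⊗ q) u
        ≈⟨ +-cong (≈-sym (constP-⊗ (p []) (pull T (∂ x q)) u)) (pull-⊗ T (∂ x p) q u) ⟩
      (constP (p []) ⊗ pull T (∂ x q)) u
        ∔ sumP (splits T) (λ s → pull (proj₁ s) (∂ x p) ⊗ pull (proj₂ s) q) u
        ≈⟨ +-congˡ (≈-sym (sumP-map _ (λ _ → ≈-refl) (splits T))) ⟩
      (constP (p []) ⊗ pull T (∂ x q)) u ∔ _ ∎
    pull-⊗ (read k ∷ T) p q u = begin
      pull (read k ∷ T) (p ⊗ q) u
        ≈⟨ head-tail u ⟩
      p [] · pull (read k ∷ T) q u ∔ tail u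
        ≈⟨ +-cong (≈-sym (constP-⊗ (p []) (pull (read k ∷ T) q) u))
                  (≈-sym (sumP-map _ (λ _ → ≈-refl) (splits T))) ⟩
      (constP (p []) ⊗ pull (read k ∷ T) q) u ∔ _ ∎
      where
      -- The splittings whose left part contains the first step `read k`.
      tail : Poly (MatVar n)
      tail = sumP (splits T) (λ s → pull (read k ∷ proj₁ s) p ⊗ pull (proj₂ s) q)
      -- A pullback that starts with `read` has constant coefficient zero, so the first summand of
      -- `⊗-∷` drops out.
      shift : ∀ s i j u → (pull (read k ∷ proj₁ s) p ⊗ pull (proj₂ s) q) ((i , j) ∷ u)
                        ≈ (∂ (i , j) (pull (read k ∷ proj₁ s) p) ⊗ pull (proj₂ s) q) u
      shift s i j u = ≈-trans (⊗-∷ (pull (read k ∷ proj₁ s) p) (pull (proj₂ s) q) (i , j) u)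
        (≈-trans (+-congʳ (zeroˡ _)) (+-identityˡ _))
      head-tail : pull (read k ∷ T) (p ⊗ q) ≐ (scale (p []) (pull (read k ∷ T) q) ⊕ tail)
      head-tail [] = ≈-sym (≈-trans (+-cong (zeroʳ (p []))
        (sumP-zero (splits T) λ {s} _ →
          ≈-trans (⊗-[] (pull (read k ∷ proj₁ s) p) (pull (proj₂ s) q)) (zeroˡ _)))
        (+-identityˡ 0#))
      head-tail ((i , j) ∷ u) = by-cases (i Finₚ.≟ k)
        where
        by-cases : Dec (i ≡ k) → pull (read k ∷ T) (p ⊗ q) ((i , j) ∷ u)
          ≈ p [] · pull (read k ∷ T) q ((i , j) ∷ u) ∔ tail ((i , j) ∷ u)
        by-cases (no i≢k) = begin
          pull (read k ∷ T) (p ⊗ q) ((i , j) ∷ u)    ≈⟨ pull-read-≢ i≢k T (p ⊗ q) j u ⟩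
          0#                                         ≈⟨ +-identityˡ 0# ⟨
          0# ∔ 0#                                    ≈⟨ +-cong
            (≈-trans (*-congˡ (pull-read-≢ i≢k T q j u)) (zeroʳ (p [])))
            (sumP-zero (splits T) λ {s} _ → ≈-trans (shift s i j u)
              (≈-trans (⊗-cong {q = pull (proj₂ s) q}
                                (pull-read-≢ i≢k (proj₁ s) p j) (λ _ → ≈-refl) u)
                       (zeroP-⊗ (pull (proj₂ s) q) u))) ⟨
          p [] · pull (read k ∷ T) q ((i , j) ∷ u) ∔ tail ((i , j) ∷ u) ∎
        by-cases (yes refl) = begin
          pull (read k ∷ T) (p ⊗ q) ((k , j) ∷ u)    ≈⟨ pull-read-≡ k T (p ⊗ q) j u ⟩
          pull T (∂ (e j) (p ⊗ q)) u                 ≈⟨ pull-∂-⊗ T (e j) p q u ⟩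
          p [] · pull T (∂ (e j) q) u ∔ pull T (∂ (e j) p ⊗ q) u
            ≈⟨ +-cong (*-congˡ (≈-sym (pull-read-≡ k T q j u))) (pull-⊗ T (∂ (e j) p) q u) ⟩
          p [] · pull (read k ∷ T) q ((k , j) ∷ u)
            ∔ sumP (splits T) (λ s → pull (proj₁ s) (∂ (e j) p) ⊗ pull (proj₂ s) q) u
            ≈⟨ +-congˡ (sumP-cong (splits T) λ s → ≈-sym (≈-trans (shift s k j u)
                 (⊗-cong {q = pull (proj₂ s) q} (pull-read-≡ k (proj₁ s) p j) (λ _ → ≈-refl) u))) ⟩
          p [] · pull (read k ∷ T) q ((k , j) ∷ u) ∔ tail ((k , j) ∷ u) ∎

    pull-constP : ∀ T a → ∃[ b ] pull T (constP a) ≐ constP b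
    pull-constP []      a = a , λ _ → ≈-refl
    pull-constP (t ∷ T) a = 0# , pull-vanishing (t ∷ T) (constP a) λ { (_ ∷ _) _ → ≈-refl }

    -- A variable has degree one, so only lists of length one can give anything nonzero: `emit`
    -- yields a constant, and `read k` yields the variable in row k and column j if x is `e j`.
    -- Injectivity of e makes j unique, so a leaf pulls back to a single leaf.
    pull-varP : ∀ T x →
      (∃[ b ] pull T (varP _≟X_ x) ≐ constP b) ⊎ (∃[ y ] pull T (varP _≟X_ x) ≐ varP matEq y)
    pull-varP []            x = inj₁ (_ , λ _ → ≈-refl)
    pull-varP (emit y ∷ []) x = inj₁ (_ , λ _ → ≈-refl)
    pull-varP (read k ∷ []) x with Finₚ.any? (λ j → e j ≟X x)
    ... | no ∄j = inj₁ (0# , λ u → ≈-trans (vanish u) (≈-sym (constP-0 u)))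
      where
      vanish : pull (read k ∷ []) (varP _≟X_ x) ≐ zeroP
      vanish []            = ≈-refl
      vanish ((i , j) ∷ u) = by-cases (i Finₚ.≟ k) u
        where
        by-cases : Dec (i ≡ k) → ∀ u → pull (read k ∷ []) (varP _≟X_ x) ((i , j) ∷ u) ≈ 0#
        by-cases (no i≢k)   u       = pull-read-≢ i≢k [] (varP _≟X_ x) j u
        by-cases (yes refl) []      = ≈-trans (pull-read-≡ k [] (varP _≟X_ x) j [])
          (reflexive (monomial-≢ _≟X_ (x ∷ []) (e j ∷ []) λ { refl → ∄j (j , refl) }))
        by-cases (yes refl) (y ∷ u) = pull-read-≡ k [] (varP _≟X_ x) j (y ∷ u)
    ... | yes (j₀ , refl) = inj₂ ((k , j₀) , eq)
      where
      p : Poly X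
      p = varP _≟X_ (e j₀)
      single : ∀ {j} → Dec (j ≡ j₀) → p (e j ∷ []) ≈ varP matEq (k , j₀) ((k , j) ∷ [])
      single (yes refl) = reflexive (≡.trans (monomial-≡ _≟X_ (e j₀ ∷ []))
                                             (≡.sym (monomial-≡ matEq ((k , j₀) ∷ []))))
      single (no j≢j₀)  = reflexive (≡.trans
        (monomial-≢ _≟X_ (e j₀ ∷ []) (e _ ∷ []) λ eq → j≢j₀ (e-injective (Listₚ.∷-injectiveˡ eq)))
        (≡.sym (monomial-≢ matEq ((k , j₀) ∷ []) ((k , _) ∷ []) λ { refl → j≢j₀ refl })))
      eq : pull (read k ∷ []) p ≐ varP matEq (k , j₀)
      eq []            = reflexive (≡.sym (monomial-≢ matEq ((k , j₀) ∷ []) [] λ ()))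
      eq ((i , j) ∷ u) = by-cases (i Finₚ.≟ k) u
        where
        by-cases : Dec (i ≡ k) → ∀ u →
          pull (read k ∷ []) p ((i , j) ∷ u) ≈ varP matEq (k , j₀) ((i , j) ∷ u)
        by-cases (no i≢k)   u       = ≈-trans (pull-read-≢ i≢k [] p j u)
          (reflexive (≡.sym (monomial-≢ matEq ((k , j₀) ∷ []) ((i , j) ∷ u) λ { refl → i≢k refl })))
        by-cases (yes refl) []      = ≈-trans (pull-read-≡ k [] p j []) (single (j Finₚ.≟ j₀))
        by-cases (yes refl) (y ∷ u) = ≈-trans (pull-read-≡ k [] p j (y ∷ u))
          (reflexive (≡.sym (monomial-≢ matEq ((k , j₀) ∷ []) ((k , j) ∷ y ∷ u) λ ())))
    pull-varP (t ∷ t′ ∷ T) x = inj₁ (0# , pull-vanishing (t ∷ t′ ∷ T) (varP _≟X_ x)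
      λ { (y ∷ y′ ∷ w) _ → reflexive (monomial-≢ _≟X_ (x ∷ []) (y ∷ y′ ∷ w) λ ()) })

    pull-emits-[] : ∀ xs p → pull (map emit xs) p [] ≡ p xs
    pull-emits-[] []       p = refl
    pull-emits-[] (x ∷ xs) p = pull-emits-[] xs (∂ x p)

    pull-emits-∷ : ∀ xs p y u → pull (map emit xs) p (y ∷ u) ≡ 0#
    pull-emits-∷ []       p y u = refl
    pull-emits-∷ (x ∷ xs) p y u = pull-emits-∷ xs (∂ x p) y u

    readWord : ∀ {l} → (Fin l → Fin n) → Vec (Fin n) l → List (MatVar n)
    readWord r v = tabulate (λ k → r k , lookup v k)

    -- The reads prescribe the rows and leave the columns v free; the emits consume nothing, so no
    -- further letter may follow. The row function r is arbitrary because the induction replaces it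
    -- by `r ∘ suc`.
    pull-reads : ∀ {l} (r : Fin l → Fin n) xs u →
      let T = tabulate (read ∘ r) ++ map emit xs in
      (∃[ v ] u ≡ readWord r v × (∀ p → pull T p u ≈ p (tabulate (e ∘ lookup v) ++ xs)))
        ⊎ ((∀ v → u ≢ readWord r v) × (∀ p → pull T p u ≈ 0#))
    pull-reads {zero}  r xs []      = inj₁ (Vec.[] , refl , λ p → reflexive (pull-emits-[] xs p))
    pull-reads {zero}  r xs (y ∷ u) = inj₂ ((λ _ ()) , λ p → reflexive (pull-emits-∷ xs p y u))
    pull-reads {suc l} r xs []      = inj₂ ((λ _ ()) , λ p → ≈-refl)
    pull-reads {suc l} r xs ((i , j) ∷ u) = by-cases (i Finₚ.≟ r zero) (pull-reads (r ∘ suc) xs u)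
      where
      T : List (Step X n)
      T = tabulate (read ∘ r ∘ suc) ++ map emit xs
      by-cases : Dec (i ≡ r zero) → _ ⊎ _ → _ ⊎ _
      by-cases (no i≢) _ = inj₂
        ( (λ v eq → i≢ (cong proj₁ (Listₚ.∷-injectiveˡ eq)))
        , (λ p → pull-read-≢ i≢ T p j u))
      by-cases (yes refl) (inj₁ (v , refl , eq)) = inj₁ (j Vec.∷ v , refl ,
        λ p → ≈-trans (pull-read-≡ i T p j u) (eq (∂ (e j) p)))
      by-cases (yes refl) (inj₂ (≢ , eq)) = inj₂
        ( (λ { (_ Vec.∷ v) eq′ → ≢ v (Listₚ.∷-injectiveʳ eq′) })
        , (λ p → ≈-trans (pull-read-≡ i T p j u) (eq (∂ (e j) p))))

  -- Coefficients of the symmetrized determinant and the Cayley permanent.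

  signF-square : ∀ k → signF k · signF k ≈ 1#
  signF-square zero    = *-identityˡ 1#
  signF-square (suc k) = begin
    - signF k · - signF k        ≈⟨ -‿distribˡ-* (signF k) (- signF k) ⟨
    - (signF k · - signF k)      ≈⟨ -‿cong (-‿distribʳ-* (signF k) (signF k)) ⟨
    - - (signF k · signF k)      ≈⟨ -‿involutive _ ⟩
    signF k · signF k            ≈⟨ signF-square k ⟩
    1#                           ∎

  module _ {N : ℕ} where

    detSum : Poly (MatVar N)
    detSum = sumP (perms N) λ σ → sumP (perms N) λ τ →
      scale (sgn σ · sgn τ) (monomial matEq (sdetWord τ σ))

    sdet-detSum : ∀ ch → scale (natF (N !)) (sdet ch N) ≐ detSum
    sdet-detSum ch w = ≈-trans (≈-sym (*-assoc _ _ _))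
      (≈-trans (*-congʳ (inverseʳ (natF (N !)) (factNonzero ch N))) (*-identityˡ _))

    -- The k-th letter records both τ(k) and σ(k), so different summands of `detSum` have different
    -- monomials and cannot interfere.
    sdetWord-injective : ∀ {τ σ τ′ σ′ : Vec (Fin N) N} → sdetWord τ σ ≡ sdetWord τ′ σ′ →
      τ ≡ τ′ × σ ≡ σ′
    sdetWord-injective {τ} {σ} {τ′} {σ′} eq =
      lookup-injective (cong proj₁ ∘ pointwise) , lookup-injective (cong proj₂ ∘ pointwise)
      where
      pointwise : ∀ i → (lookup τ i , lookup σ i) ≡ (lookup τ′ i , lookup σ′ i)
      pointwise = tabulate-injective
        (≡.trans (≡.sym (Listₚ.map-tabulate id _)) (≡.trans eq (Listₚ.map-tabulate id _)))

    detSum-diagonal-perm : ∀ {v} → v ∈ perms N → detSum (sdetWord v v) ≈ 1#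
    detSum-diagonal-perm {v} v∈ = begin
      detSum w
        ≈⟨ sumP-single (perms-unique N) v∈ (λ σ≢v → sumP-zero (perms N) λ {τ} _ →
             off τ _ (σ≢v ∘ ≡.sym ∘ proj₂)) ⟩
      sumP (perms N) (λ τ → scale (sgn v · sgn τ) (monomial matEq (sdetWord τ v))) w
        ≈⟨ sumP-single (perms-unique N) v∈ (λ {τ} τ≢v → off τ v (τ≢v ∘ ≡.sym ∘ proj₁)) ⟩
      (sgn v · sgn v) · monomial matEq w w
        ≈⟨ *-cong (signF-square (inversions v)) (reflexive (monomial-≡ matEq w)) ⟩
      1# · 1#
        ≈⟨ *-identityˡ 1# ⟩
      1# ∎
      where
      w : List (MatVar N)
      w = sdetWord v v
      off : ∀ τ σ → ¬ (v ≡ τ × v ≡ σ) →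
        (sgn σ · sgn τ) · monomial matEq (sdetWord τ σ) w ≈ 0#
      off τ σ ≢ = ≈-trans
        (*-congˡ (reflexive (monomial-≢ matEq (sdetWord τ σ) w (≢ ∘ sdetWord-injective)))) (zeroʳ _)

    -- A surviving summand would force σ = v, although σ is taken from `perms`.
    detSum-diagonal-nonperm : ∀ {v} → ¬ (v ∈ perms N) → detSum (sdetWord v v) ≈ 0#
    detSum-diagonal-nonperm {v} v∉ = sumP-zero (perms N) λ {σ} σ∈ → sumP-zero (perms N) λ {τ} _ →
      ≈-trans (*-congˡ (reflexive (monomial-≢ matEq (sdetWord τ σ) (sdetWord v v)
        λ eq → v∉ (subst (_∈ perms N) (≡.sym (proj₂ (sdetWord-injective {v} {v} {τ} {σ} eq))) σ∈))))
        (zeroʳ _)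

    cpermWord-injective : ∀ {v w : Vec (Fin N) N} → cpermWord v ≡ cpermWord w → v ≡ w
    cpermWord-injective eq = lookup-injective (cong proj₂ ∘ tabulate-injective
      (≡.trans (≡.sym (Listₚ.map-tabulate id _)) (≡.trans eq (Listₚ.map-tabulate id _))))

    Cperm-perm : ∀ {v} → v ∈ perms N → Cperm N (cpermWord v) ≈ 1#
    Cperm-perm {v} v∈ = ≈-trans
      (sumP-single (perms-unique N) v∈ λ {σ} σ≢v →
        reflexive (monomial-≢ matEq (cpermWord σ) (cpermWord v)
          (σ≢v ∘ ≡.sym ∘ cpermWord-injective)))
      (reflexive (monomial-≡ matEq (cpermWord v)))

    Cperm-zero : ∀ {u} → (∀ {v} → v ∈ perms N → u ≢ cpermWord v) → Cperm N u ≈ 0#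
    Cperm-zero {u} ≢ = sumP-zero (perms N) λ {σ} σ∈ →
      reflexive (monomial-≢ matEq (cpermWord σ) u (≢ σ∈))

  -- The Cayley permanent as a pullback of the symmetrized determinant.

  module SdetToCperm (n m : ℕ) where

    diagonal : ∀ {N} → Fin N → MatVar N
    diagonal i = i , i

    diagonal-↑ˡ-injective : Injective _≡_ _≡_ (λ (j : Fin n) → diagonal (j ↑ˡ m))
    diagonal-↑ˡ-injective eq = Finₚ.↑ˡ-injective m _ _ (cong proj₁ eq)

    open Pullback (matEq {n + m}) {n} (λ j → diagonal (j ↑ˡ m))
      diagonal-↑ˡ-injective public

    fixed : List (MatVar (n + m))
    fixed = tabulate {n = m} (λ k → diagonal (n ↑ʳ k))

    -- Rows are read in increasing order, as the Cayley permanent requires; the emitted letters then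
    -- fill the word up to the degree n + m of `sdet`.
    steps : List (Step (MatVar (n + m)) n)
    steps = tabulate {n = n} read ++ map emit fixed

    length-steps : length steps ≡ n + m
    length-steps = ≡.trans (Listₚ.length-++ (tabulate {n = n} read))
      (cong₂ _+_ (Listₚ.length-tabulate {n = n} read)
        (≡.trans (Listₚ.length-map emit fixed) (Listₚ.length-tabulate {n = m} _)))

    sdetWord-pad : ∀ v → sdetWord (pad m v) (pad m v) ≡
      tabulate (λ k → diagonal (lookup v k ↑ˡ m)) ++ fixed
    sdetWord-pad v = ≡.trans (Listₚ.map-tabulate id _) (≡.trans (tabulate-+ n _)
      (cong₂ _++_ (Listₚ.tabulate-cong (λ i → cong diagonal (lookup-pad-↑ˡ m v i)))
                  (Listₚ.tabulate-cong (λ i → cong diagonal (lookup-pad-↑ʳ m v i)))))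

    -- A word with rows in order and columns v translates to the diagonal word of `pad m v`. Both
    -- coefficients are then 1 or 0 according to whether v is a permutation, since `pad m v` is
    -- injective exactly when v is. At all other words both sides vanish.
    pull-detSum : pull steps detSum ≐ Cperm n
    pull-detSum u with pull-reads id fixed u
    ... | inj₂ (≢ , eq) = ≈-trans (eq detSum) (≈-sym (Cperm-zero λ {v} _ u≡ →
            ≢ v (≡.trans u≡ (Listₚ.map-tabulate id _))))
    ... | inj₁ (v , refl , eq) = ≈-trans (eq detSum)
      (≈-trans (reflexive (cong detSum (≡.sym (sdetWord-pad v))))
        (≈-trans diagonal-coefficient (reflexive (cong (Cperm n) (Listₚ.map-tabulate id _)))))
      where
      diagonal-coefficient : detSum (sdetWord (pad m v) (pad m v)) ≈ Cperm n (cpermWord v)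
      diagonal-coefficient with isPerm v Bool.≟ true
      ... | yes perm = ≈-trans
        (detSum-diagonal-perm {v = pad m v}
          (∈-perms⁺ (pad m v) (pad-injective⁺ m v (isPerm⇒injective v perm))))
        (≈-sym (Cperm-perm {v = v} (∈-perms⁺ v (isPerm⇒injective v perm))))
      ... | no ¬perm = ≈-trans
        (detSum-diagonal-nonperm {v = pad m v} λ p →
          ¬perm (injective⇒isPerm v (pad-injective⁻ m v (∈-perms⁻ (pad m v) p))))
        (≈-sym (Cperm-zero λ { p eq → ¬perm (injective⇒isPerm v
          (∈-perms⁻ v (subst (_∈ perms n) (≡.sym (cpermWord-injective {v = v} eq)) p))) }))

    Cperm-from-sdet : ∀ ch → (constP (natF ((n + m) !)) ⊗ pull steps (sdet ch (n + m))) ≐ Cperm n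
    Cperm-from-sdet ch u = begin
      (constP a ⊗ pull steps (sdet ch (n + m))) u   ≈⟨ constP-⊗ a (pull steps (sdet ch (n + m))) u ⟩
      a · pull steps (sdet ch (n + m)) u             ≈⟨ pull-scale steps a (sdet ch (n + m)) u ⟨
      pull steps (scale a (sdet ch (n + m))) u       ≈⟨ pull-cong steps (sdet-detSum ch) u ⟩
      pull steps detSum u                            ≈⟨ pull-detSum u ⟩
      Cperm n u                                      ∎
      where
      a : Carrier
      a = natF ((n + m) !)

  -- Extending circuits by further gates.

  module Extensions {V : Set} (_≟_ : DecidableEquality V) where

    record Has {k} (C : Circuit V k) (p : Poly V) : Set ℓ where
      constructor _,_
      field
        node     : Fin k
        computes : evalNodes _≟_ C node ≐ p

    -- Stated for computed polynomials and not for node indices, because indices count back from the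
    -- newest gate and shift with every addition.
    _⊑_ : ∀ {k k′} → Circuit V k → Circuit V k′ → Set (c ⊔ ℓ)
    C ⊑ C′ = ∀ {p} → Has C p → Has C′ p

    ▷-⊑ : ∀ {k} (C : Circuit V k) g → C ⊑ (C ▷ g)
    ▷-⊑ C g (i , eq) = suc i , eq

    Has-cong : ∀ {k} {C : Circuit V k} {p q} → p ≐ q → Has C p → Has C q
    Has-cong p≐q (i , eq) = i , ≐-trans eq p≐q

    Extension : ∀ {k} → Circuit V k → ℕ → List (Poly V) → Set (c ⊔ ℓ)
    Extension {k} C m ps =
      Σ[ k′ ∈ ℕ ] Σ[ C′ ∈ Circuit V k′ ] k′ ≤ m + k × C ⊑ C′ × All (Has C′) ps

    module _ {k} {C : Circuit V k} where

      weaken : ∀ {m m′ ps} → m ≤ m′ → Extension C m ps → Extension C m′ ps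
      weaken m≤m′ (k′ , C′ , k′≤ , C⊑ , has) =
        k′ , C′ , ℕₚ.≤-trans k′≤ (ℕₚ.+-monoˡ-≤ k m≤m′) , C⊑ , has

      extension-cong : ∀ {m p q} → p ≐ q → Extension C m (p ∷ []) → Extension C m (q ∷ [])
      extension-cong p≐q (k′ , C′ , k′≤ , C⊑ , has ∷ []) =
        k′ , C′ , k′≤ , C⊑ , Has-cong p≐q has ∷ []

      extend-gate : ∀ g → Extension C 1 (evalGate _≟_ (evalNodes _≟_ C) g ∷ [])
      extend-gate g = suc k , C ▷ g , ℕₚ.≤-refl , ▷-⊑ C g , (zero , λ _ → ≈-refl) ∷ []

      extend-⊕ : ∀ {p q} → Has C p → Has C q → Extension C 1 ((p ⊕ q) ∷ [])
      extend-⊕ (i , eq) (j , eq′) = extension-cong (⊕-cong eq eq′) (extend-gate (add i j))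

      extend-⊗ : ∀ {p q} → Has C p → Has C q → Extension C 1 ((p ⊗ q) ∷ [])
      extend-⊗ (i , eq) (j , eq′) = extension-cong (⊗-cong eq eq′) (extend-gate (mul i j))

      -- The circuit grows from one element to the next, so `step` must work over every extension of
      -- C.
      extend-all : ∀ {A : Set} (f : A → Poly V) {m} xs →
        (∀ {k′} (C′ : Circuit V k′) → C ⊑ C′ → ∀ {x} → x ∈ xs → Extension C′ m (f x ∷ [])) →
        Extension C (length xs * m) (map f xs)
      extend-all f     []       step = k , C , ℕₚ.≤-refl , id , []
      extend-all f {m} (x ∷ xs) step
        with extend-all f xs (λ C′ C⊑C′ → step C′ C⊑C′ ∘ there)
      ... | k₁ , C₁ , k₁≤ , C⊑C₁ , has with step C₁ C⊑C₁ (here refl)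
      ... | k₂ , C₂ , k₂≤ , C₁⊑C₂ , has′ ∷ [] =
        k₂ , C₂ ,
        ℕₚ.≤-trans k₂≤ (ℕₚ.≤-trans (ℕₚ.+-monoʳ-≤ m k₁≤)
          (ℕₚ.≤-reflexive (≡.sym (ℕₚ.+-assoc m (length xs * m) k)))) ,
        (λ h → C₁⊑C₂ (C⊑C₁ h)) , has′ ∷ All.map (λ h → C₁⊑C₂ h) has

    -- One constant gate starts the sum at zero, and each term costs a multiplication and an
    -- addition.
    extend-sumP : ∀ {k} {C : Circuit V k} {A : Set} (f g : A → Poly V) xs →
      (∀ {x} → x ∈ xs → Has C (f x) × Has C (g x)) →
      Extension C (suc (length xs * 2)) (sumP xs (λ x → f x ⊗ g x) ∷ [])
    extend-sumP f g []       has = extension-cong constP-0 (extend-gate (const 0#))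
    extend-sumP {k} f g (x ∷ xs) has with extend-sumP f g xs (has ∘ there)
    ... | k₁ , C₁ , k₁≤ , C⊑C₁ , Σ∈ ∷ []
      with extend-⊗ (C⊑C₁ (proj₁ (has (here refl)))) (C⊑C₁ (proj₂ (has (here refl))))
    ... | k₂ , C₂ , k₂≤ , C₁⊑C₂ , p∈ ∷ [] with extend-⊕ p∈ (C₁⊑C₂ Σ∈)
    ... | k₃ , C₃ , k₃≤ , C₂⊑C₃ , Σ∈′ ∷ [] =
      k₃ , C₃ ,
      ℕₚ.≤-trans k₃≤ (s≤s (ℕₚ.≤-trans k₂≤ (s≤s k₁≤))) ,
      (λ h → C₂⊑C₃ (C₁⊑C₂ (C⊑C₁ h))) , Σ∈′ ∷ []

  -- Circuits for pullbacks.

  module CircuitPullback {X : Set} (_≟X_ : DecidableEquality X) {n : ℕ}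
                         (e : Fin n → X) (e-injective : Injective _≡_ _≡_ e)
                         (S : List (Step X n)) where

    open Pullback _≟X_ e e-injective
    open Extensions (matEq {n})

    -- The cost of a multiplication gate by `extend-sumP`, with at most |S| + 1 splittings; every
    -- other gate costs one node.
    gateCost : ℕ
    gateCost = suc (suc (length S) * 2)

    pull-gate : ∀ {k} (C : Circuit X k) g {k′} (C′ : Circuit (MatVar n) k′) →
      (∀ i {T} → T ∈ factors S → Has C′ (pull T (evalNodes _≟X_ C i))) →
      ∀ {T} → T ∈ factors S →
      Extension C′ gateCost (pull T (evalGate _≟X_ (evalNodes _≟X_ C) g) ∷ [])
    pull-gate C (var x) C′ has {T} T∈ with pull-varP T x
    ... | inj₁ (b , eq) = weaken (s≤s z≤n) (extension-cong (≐-sym eq) (extend-gate (const b)))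
    ... | inj₂ (y , eq) = weaken (s≤s z≤n) (extension-cong (≐-sym eq) (extend-gate (var y)))
    pull-gate C (const a) C′ has {T} T∈ with pull-constP T a
    ... | b , eq = weaken (s≤s z≤n) (extension-cong (≐-sym eq) (extend-gate (const b)))
    pull-gate C (add i j) C′ has {T} T∈ = weaken (s≤s z≤n)
      (extension-cong (≐-sym (pull-⊕ T _ _)) (extend-⊕ (has i T∈) (has j T∈)))
    pull-gate C (mul i j) C′ has {T} T∈ = weaken
      -- A factor T of S has |T| + 1 splittings, hence at most |S| + 1.
      (s≤s (ℕₚ.*-monoˡ-≤ 2 (subst (_≤ suc (length S)) (≡.sym (length-splits T))
        (s≤s (length-factor S T∈)))))
      (extension-cong (≐-sym (pull-⊗ T (evalNodes _≟X_ C i) (evalNodes _≟X_ C j)))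
        (extend-sumP (λ s → pull (proj₁ s) (evalNodes _≟X_ C i))
                     (λ s → pull (proj₂ s) (evalNodes _≟X_ C j)) (splits T)
          λ s∈ → has i (proj₁ (factors-splits S T∈ s∈)) , has j (proj₂ (factors-splits S T∈ s∈))))

    nodeCost : ℕ
    nodeCost = length (factors S) * gateCost

    -- Keeping the pullbacks along all factors, and not along S alone, is what makes the induction
    -- on gates close, since a product needs shorter factors of both its arguments.
    pull-circuit : ∀ {k} (C : Circuit X k) →
      Σ[ k′ ∈ ℕ ] Σ[ C′ ∈ Circuit (MatVar n) k′ ] k′ ≤ k * nodeCost ×
        (∀ i {T} → T ∈ factors S → Has C′ (pull T (evalNodes _≟X_ C i)))
    pull-circuit []      = 0 , [] , z≤n , λ ()
    pull-circuit (C ▷ g) with pull-circuit C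
    ... | k₁ , C₁ , k₁≤ , has
      with extend-all {C = C₁} (λ T → pull T (evalGate _≟X_ (evalNodes _≟X_ C) g)) (factors S)
             (λ C′ C₁⊑C′ → pull-gate C g C′ (λ i T∈ → C₁⊑C′ (has i T∈)))
    ... | k₂ , C₂ , k₂≤ , C₁⊑C₂ , new =
      k₂ , C₂ , ℕₚ.≤-trans k₂≤ (ℕₚ.+-monoʳ-≤ nodeCost k₁≤) ,
      λ { zero    T∈ → All.lookup (Allₚ.map⁻ new) T∈
        ; (suc i) T∈ → C₁⊑C₂ (has i T∈) }

  -- Size of the resulting circuits.

  -- Bounds `nodeCost` for a step list of length L: (L + 1)² factors, each at the price `gateCost`.
  pullCost : ℕ → ℕ
  pullCost L = (suc L * suc L) * suc (suc L * 2)

  -- The 2 counts the constant (n + m)! and its multiplication with the pullback, which undo the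
  -- normalization of `sdet`.
  Cperm-size : ∀ ch n m {s} → ComputedInSize matEq (sdet ch (n + m)) s →
    ∃[ s′ ] s′ ≤ 2 + s * pullCost (n + m) × ComputedInSize matEq (Cperm n) s′
  Cperm-size ch n m {s} (C , out , eq) = result
    where
    open SdetToCperm n m
    open CircuitPullback matEq (λ j → diagonal (j ↑ˡ m)) diagonal-↑ˡ-injective steps
    open Extensions (matEq {n})

    nodeCost≤ : nodeCost ≤ pullCost (n + m)
    nodeCost≤ = subst (λ L → nodeCost ≤ pullCost L) length-steps
      (ℕₚ.*-monoˡ-≤ gateCost (length-factors steps))

    steps∈ : steps ∈ factors steps
    steps∈ = subst (λ S → steps ∈ factors S) (Listₚ.++-identityʳ steps) (∈-factors⁺ [] steps [])

    result : ∃[ s′ ] s′ ≤ 2 + s * pullCost (n + m) × ComputedInSize matEq (Cperm n) s′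
    result with pull-circuit C
    ... | k₁ , C₁ , k₁≤ , has with extend-gate {C = C₁} (const (natF ((n + m) !)))
    ... | k₂ , C₂ , k₂≤ , C₁⊑C₂ , a∈ ∷ [] with extend-⊗ a∈ (C₁⊑C₂ (has out steps∈))
    ... | k₃ , C₃ , k₃≤ , _ , (i , eq′) ∷ [] =
      k₃ ,
      ℕₚ.≤-trans k₃≤ (s≤s (ℕₚ.≤-trans k₂≤ (s≤s (ℕₚ.≤-trans k₁≤ (ℕₚ.*-monoʳ-≤ s nodeCost≤))))) ,
      C₃ , i ,
      ≐-trans eq′ (≐-trans (⊗-cong (λ _ → ≈-refl) (pull-cong steps eq)) (Cperm-from-sdet ch))

theorem6p1 : {c ℓ : Level} (F : Field c ℓ) (ch : FieldOps.CharZero F) →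
    NCPoly.PolySizeFamily F (λ n → NCPoly.MatVar F (2 * n)) (λ n → NCPoly.matEq F)
    (λ n → NCPoly.sdet F ch (2 * n)) →
    NCPoly.PolySizeFamily F (NCPoly.MatVar F) (λ n → NCPoly.matEq F)
    (λ n → NCPoly.Cperm F n)
theorem6p1 F ch (a , b , circuits) = proj₁ size-bounded , proj₁ (proj₂ size-bounded) , λ n →
  let s , s≤ , computes = circuits n
      -- The choice m = n + 0 makes n + m definitionally equal to `2 * n`.
      s′ , s′≤ , computes′ = Cperm-size ch n (n + 0) computes
  in s′ , ℕₚ.≤-trans s′≤ (ℕₚ.≤-trans (ℕₚ.+-monoʳ-≤ 2 (ℕₚ.*-monoˡ-≤ (pullCost (2 * n)) s≤))
                                     (proj₂ (proj₂ size-bounded) n))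
        , computes′
  where
  open Polynomials F
  L+1-bounded : PolyBounded (λ n → suc (2 * n))
  L+1-bounded =
    +-polyBounded (const-polyBounded 1) (*-polyBounded (const-polyBounded 2) id-polyBounded)
  -- The bound of `Cperm-size` with s replaced by its given bound; the proof follows the shape of
  -- `pullCost`.
  size-bounded : PolyBounded (λ n → 2 + (a * n ^ b + a) * pullCost (2 * n))
  size-bounded = +-polyBounded (const-polyBounded 2)
    (*-polyBounded (a , b , λ _ → ℕₚ.≤-refl)
      (*-polyBounded (*-polyBounded L+1-bounded L+1-bounded)
        (+-polyBounded (const-polyBounded 1) (*-polyBounded L+1-bounded (const-polyBounded 2)))))
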